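{- Let $a_0=1$ and, for $n\ge 1$, let $a_n=|\mathcal{S}_n(31;\,2\to 2)|$. Then for every $n\ge 1$, $$a_n = d_n + \sum_{m=1}^{n} d_{n-m}\, a_{m-1},$$ where $d_j$ denotes the $j$-th derangement number.
   Context: $[n]=\{1,\dots,n\}$, and $\mathcal{S}_n$ is the set of permutations $\pi=\pi_1\pi_2\cdots\pi_n$ of $[n]$ in one-line notation. The permutation $\hat\pi$: for $\pi\in\mathcal{S}_n$, $\hat\pi\in\mathcal{S}_n$ is the permutation whose cycle form is obtained from the word $\pi_1\cdots\pi_n$ by inserting a left parenthesis before each left-to-right maximum (an entry larger than all entries to its left) and a right parenthesis immediately before the next left-to-right maximum, or at the end of the word. A cycle $(c_1,c_2,\dots,c_s)$ means $c_1\mapsto c_2\mapsto\cdots\mapsto c_s\mapsto c_1$. Example: if $\pi=2537164$ then $\hat\pi=(2)(53)(7164)$. Arrow patterns: an arrow pattern of size $k$ is a pair $(\nu;H)$ where $\nu=\nu_1\cdots\nu_m$ is a word of distinct positive integers, $H$ is a collection of arrows $b_i\to c_i$, and the set of all integers appearing in $\nu$ or $H$ is $[k]$. A permutation $\pi\in\mathcal{S}_n$ contains $(\nu;H)$ if there are a set $X=\{x_1<x_2<\cdots<x_k\}\subseteq[n]$ and indices $t_1<\cdots<t_m$ such that $\pi_{t_1}\pi_{t_2}\cdots\pi_{t_m}=x_{\nu_1}x_{\nu_2}\cdots x_{\nu_m}$ and $\hat\pi(x_{b_i})=x_{c_i}$ for every arrow $b_i\to c_i$ in $H$. Otherwise $\pi$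 avoids $(\nu;H)$. $\mathcal{S}_n(\nu;H)$ is the set of permutations in $\mathcal{S}_n$ avoiding $(\nu;H)$. The derangement number $d_j$ is the number of permutations of $[j]$ without fixed points ($d_0=1$, $d_1=0$). -}

module Defs where

open import Data.Fin.Base using (Fin; zero; suc; _<_)
open import Data.Fin.Properties using (_≟_; _<?_; all?; any?)
open import Data.List.Base as List
  using (List; []; _∷_; _++_; allFin; cartesianProductWith; filter; foldr; length)
open import Data.List.Membership.Propositional using (_∈_)
import Data.List.Relation.Unary.All as All
open import Data.List.Relation.Unary.All using (All)
open import Data.List.Relation.Unary.Any using (here; there)
open import Data.Nat.Base using (ℕ; zero; suc)
open import Data.Product using (_×_; _,_; proj₁; proj₂; ∃; ∃-syntax)
open import Data.Vec.Base as Vec using (Vec; []; _∷_; lookup; toList)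
import Data.Vec.Properties as Vec
import Data.Vec.Relation.Unary.AllPairs as AllPairs
open import Data.Vec.Relation.Unary.AllPairs using (AllPairs; []; _∷_)
import Data.Vec.Relation.Unary.All as VecAll
open import Data.Vec.Relation.Unary.Unique.Propositional using (Unique)
open import Function.Base using (_∘_; id)
open import Relation.Binary.PropositionalEquality using (_≡_; _≢_; refl)
open import Relation.Nullary using (¬_; Dec; yes; no; ¬?; _×-dec_; map′)
open import Relation.Unary using (Decidable)

private
  variable
    k m n : ℕ

-- Throughout, [n] is represented by Fin n: the element i of Fin n stands for
-- the integer toℕ i + 1, both for entries and for positions of a word, and
-- likewise for the labels 1, …, k of an arrow pattern of size k.

words : ∀ m n → List (Vec (Fin n) m)
words zero    n = [] ∷ []
words (suc m) n = cartesianProductWith _∷_ (allFin n) (words m n)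

-- The words π₁ ⋯ πₙ over [n] without repeated letters, i.e. the permutations
-- of [n] in one-line notation, each listed exactly once.

permutations : ∀ n → List (Vec (Fin n) n)
permutations n = filter (AllPairs.allPairs? λ i j → ¬? (i ≟ j)) (words n n)

-- blocks cuts a word immediately before each left-to-right maximum.
-- blocksFrom p w reads w when the maximum so far is p; it returns what
-- remains of the current block, and the blocks that follow it.

blocksFrom : Fin n → List (Fin n) → List (Fin n) × List (List (Fin n))
blocksFrom p []      = [] , []
blocksFrom p (x ∷ w) with p <? x
... | yes _ = let b , bs = blocksFrom x w in [] , (x ∷ b) ∷ bs
... | no  _ = let b , bs = blocksFrom p w in x ∷ b , bs

blocks : List (Fin n) → List (List (Fin n))
blocks []      = []
blocks (x ∷ w) = let b , bs = blocksFrom x w in (x ∷ b) ∷ bs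

-- stepFrom c₁ c w is the part of the cycle (c₁, …, c, w) acting on c and w:
-- each letter goes to the next, the last one to c₁. Letters outside the cycle
-- are fixed.

stepFrom : Fin n → Fin n → List (Fin n) → Fin n → Fin n
stepFrom c₁ c []      x with x ≟ c
... | yes _ = c₁
... | no  _ = x
stepFrom c₁ c (d ∷ w) x with x ≟ c
... | yes _ = d
... | no  _ = stepFrom c₁ d w x

cycle : List (Fin n) → Fin n → Fin n
cycle []      = id
cycle (c ∷ w) = stepFrom c c w

-- The permutation π̂, as the product of the cycles in its cycle form. These
-- are disjoint when π is a permutation, so the order of the factors is
-- immaterial.

hat : Vec (Fin n) n → Fin n → Fin n
hat π = foldr (λ c f → cycle c ∘ f) id (blocks (toList π))

record ArrowPattern (k : ℕ) : Set where
  field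
    {size}   : ℕ
    ν        : Vec (Fin k) size
    distinct : Unique ν
    H        : List (Fin k × Fin k)
    covers   : ∀ i → i ∈ toList ν ++ List.map proj₁ H ++ List.map proj₂ H

module _ (P : ArrowPattern k) where
  open ArrowPattern P

  Occurrence : Vec (Fin n) n → Vec (Fin n) k → Vec (Fin n) size → Set
  Occurrence π x t =
      AllPairs _<_ x
    × AllPairs _<_ t
    × Vec.map (lookup π) t ≡ Vec.map (lookup x) ν
    × All (λ (b , c) → hat π (lookup x b) ≡ lookup x c) H

  Contains : Vec (Fin n) n → Set
  Contains π = ∃[ x ] ∃[ t ] Occurrence π x t

  Avoids : Vec (Fin n) n → Set
  Avoids π = ¬ Contains π

∃-vec? : ∀ m {P : Vec (Fin n) m → Set} → Decidable P → Dec (∃ P)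
∃-vec? zero    P? = map′ (λ p → [] , p) (λ { ([] , p) → p }) (P? [])
∃-vec? (suc m) P? =
  map′ (λ (i , v , p) → i ∷ v , p) (λ { (i ∷ v , p) → i , v , p })
       (any? λ i → ∃-vec? m λ v → P? (i ∷ v))

avoids? : (P : ArrowPattern k) → Decidable (Avoids P {n})
avoids? {k} P π = ¬? (∃-vec? k λ x → ∃-vec? size λ t →
    AllPairs.allPairs? _<?_ x
  ×-dec AllPairs.allPairs? _<?_ t
  ×-dec Vec.≡-dec _≟_ (Vec.map (lookup π) t) (Vec.map (lookup x) ν)
  ×-dec All.all? (λ (b , c) → hat π (lookup x b) ≟ lookup x c) H)
  where open ArrowPattern P

avoiders : ∀ n → ArrowPattern k → List (Vec (Fin n) n)
avoiders n P = filter (avoids? P) (permutations n)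

pattern31∣2→2 : ArrowPattern 3
pattern31∣2→2 = record
  { ν        = suc (suc zero) ∷ zero ∷ []
  ; distinct = ((λ ()) VecAll.∷ VecAll.[]) ∷ VecAll.[] ∷ []
  ; H        = (suc zero , suc zero) ∷ []
  ; covers   = λ { zero             → there (here refl)
                 ; (suc zero)       → there (there (here refl))
                 ; (suc (suc zero)) → here refl }
  }

a : ℕ → ℕ
a zero      = 1
a n@(suc _) = length (avoiders n pattern31∣2→2)

FixedPointFree : Vec (Fin n) n → Set
FixedPointFree π = ∀ i → lookup π i ≢ i

fixedPointFree? : Decidable (FixedPointFree {n})
fixedPointFree? π = all? λ i → ¬? (lookup π i ≟ i)

d : ℕ → ℕ
d j = length (filter fixedPointFree? (permutations j))

{-# OPTIONS --safe #-}
module Submission where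

-- A letter y of π = u y v is fixed by π̂ exactly when it is a block of its own:
-- all of u is below y, and v is empty or starts above y. Then no later letter
-- may be below y in an avoider, because the first letter of v would play the
-- role of 3. So π avoids the pattern iff every fixed point y of π̂ has all of u
-- below it and all of v above it. Cutting an avoider at its last such y = m
-- leaves an avoider of [m − 1] and a permutation τ of the n − m letters above
-- m for which τ̂ has no fixed point; as π ↦ π̂ is a bijection, there are d (n − m)
-- of the latter, and d n avoiders have no such y at all.

open import Data.Empty using (⊥; ⊥-elim)
open import Data.Fin.Base using (Fin; zero; suc; toℕ; fromℕ<) renaming (_≤_ to _≤ᶠ_; _<_ to _<ᶠ_)
open import Data.Fin.Properties as Fin using (_≟_; _<?_; all?; toℕ-fromℕ<; toℕ-injective; toℕ<n)
open import Data.List.Base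
  using (List; []; _∷_; [_]; _++_; _∷ʳ_; allFin; applyUpTo; cartesianProduct; concatMap; filter;
         foldr; length; map; take; upTo)
import Data.List.Membership.DecPropositional as DecMembership
open import Data.List.Membership.Propositional using (_∈_; _∉_; find; lose)
open import Data.List.Membership.Propositional.Properties
  using (∈-++⁺ˡ; ∈-++⁺ʳ; ∈-++⁻; ∈-allFin; ∈-cartesianProduct⁺; ∈-cartesianProduct⁻;
         ∈-cartesianProductWith⁺; ∈-concatMap⁺; ∈-concatMap⁻; ∈-filter⁺; ∈-filter⁻; ∈-insert;
         ∈-map⁺; ∈-map⁻; ∈-upTo⁺; ∈-upTo⁻; ∈-∃++)
open import Data.List.Properties
  using (++-assoc; ++-identityʳ; length-++; length-map; length-tabulate; length-upTo; map-++;
         map-applyUpTo; map-cong; map-id-local; map-injective; map-upTo; map-∘; ∷-injective)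
open import Data.List.Relation.Binary.Disjoint.Propositional using (Disjoint)
open import Data.List.Relation.Binary.Permutation.Propositional.Properties
  using (shift; ∈-resp-↭; ↭-length)
open import Data.List.Relation.Binary.Subset.Propositional using (_⊆_)
open import Data.List.Relation.Unary.All as All using (All; []; _∷_)
import Data.List.Relation.Unary.All.Properties as All
open import Data.List.Relation.Unary.AllPairs as AllPairs using (AllPairs; []; _∷_)
import Data.List.Relation.Unary.AllPairs.Properties as AllPairs
open import Data.List.Relation.Unary.Any using (here; there)
open import Data.List.Relation.Unary.Unique.Propositional using (Unique)
import Data.List.Relation.Unary.Unique.Propositional.Properties as Unique
open import Data.List.Relation.Unary.Unique.Propositional.Properties
  using () renaming (Unique[x∷xs]⇒x∉xs to head∉tail)
open import Data.List.Reverse using (Reverse; []; _∶_∶ʳ_; reverseView)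
open import Data.Nat.Base
  using (ℕ; zero; suc; z≤n; s≤s; z<s; s<s; _+_; _*_; _∸_; _≤_; _<_)
open import Data.Nat.ListAction using (sum)
import Data.Nat.Properties as ℕ
open import Data.Product using (_×_; _,_; proj₁; proj₂; ∃-syntax; ∃₂)
open import Data.Product.Properties using (,-injectiveˡ; ,-injectiveʳ)
open import Data.Sum.Base using (_⊎_; inj₁; inj₂)
open import Data.Vec.Base using (Vec; []; _∷_; lookup; tabulate; toList)
import Data.Vec.Membership.Propositional.Properties as Vec
import Data.Vec.Properties as Vec
import Data.Vec.Relation.Unary.All as VecAll
import Data.Vec.Relation.Unary.All.Properties as VecAll
import Data.Vec.Relation.Unary.AllPairs as VecAllPairs
import Data.Vec.Relation.Unary.Unique.Propositional as Vec
import Data.Vec.Relation.Unary.Unique.Propositional.Properties as Vec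
open import Function.Base using (_∘_; id)
open import Level using (0ℓ)
open import Relation.Binary.Core using (Rel)
open import Relation.Binary.Definitions using (tri<; tri≈; tri>)
open import Relation.Binary.PropositionalEquality hiding ([_])
open import Relation.Nullary using (¬_; Dec; yes; no; contradiction; ¬?; _×-dec_)
open import Relation.Unary using (Decidable)
open import Defs

private
  variable
    A B : Set
    m n : ℕ

-- Duplicate-free lists and the pigeonhole principle.

AllPairs-++⁻ : ∀ {R : Rel A 0ℓ} xs {ys} → AllPairs R (xs ++ ys) →
               AllPairs R xs × AllPairs R ys × All (λ x → All (R x) ys) xs
AllPairs-++⁻ []       ps       = [] , ps , []
AllPairs-++⁻ (x ∷ xs) (p ∷ ps) =
  let ps₁ , ps₂ , ps₁₂ = AllPairs-++⁻ xs ps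
  in All.++⁻ˡ xs p ∷ ps₁ , ps₂ , All.++⁻ʳ xs p ∷ ps₁₂

module _ (u : List A) {y : A} {v : List A} (! : Unique (u ++ y ∷ v)) where

  private split = AllPairs-++⁻ u !

  Unique⇒∉ˡ : y ∉ u
  Unique⇒∉ˡ y∈u = All.head (All.lookup (proj₂ (proj₂ split)) y∈u) refl

  Unique⇒∉ʳ : y ∉ v
  Unique⇒∉ʳ = head∉tail (proj₁ (proj₂ split))

∈-delete : ∀ u {v} {x z : A} → z ∈ u ++ x ∷ v → z ≢ x → z ∈ u ++ v
∈-delete u z∈ z≢x with ∈-resp-↭ (shift _ u _) z∈
... | here z≡x  = contradiction z≡x z≢x
... | there z∈′ = z∈′

-- Striking the head of `xs` out of `ys` shortens `ys` by one, and the tail of `xs` survives in the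
-- remainder because the head does not recur in it.
length-⊆ : {xs ys : List A} → Unique xs → xs ⊆ ys → length xs ≤ length ys
length-⊆ {xs = []}     []           xs⊆ys = z≤n
length-⊆ {xs = x ∷ xs} (x∉xs ∷ xs!) xs⊆ys with ∈-∃++ (xs⊆ys (here refl))
... | u , v , refl = subst (suc (length xs) ≤_) (sym (↭-length (shift x u v)))
  (s≤s (length-⊆ xs! λ z∈xs → ∈-delete u (xs⊆ys (there z∈xs)) (All.lookup x∉xs z∈xs ∘ sym)))

-- Pigeonhole, by the same deletion: when `ys` is no longer than `xs`, nothing is left over in it.
-- This later turns injectivity into surjectivity.
⊆-reverse : {xs ys : List A} → Unique xs → xs ⊆ ys → length ys ≤ length xs → ys ⊆ xs
⊆-reverse {xs = []}     {[]} []           xs⊆ys ∣ys∣≤∣xs∣ ()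
⊆-reverse {xs = x ∷ xs}      (x∉xs ∷ xs!) xs⊆ys ∣ys∣≤∣xs∣ with ∈-∃++ (xs⊆ys (here refl))
... | u , v , refl = λ z∈ys → case (∈-resp-↭ (shift x u v) z∈ys)
  where
  xs⊆uv : xs ⊆ u ++ v
  xs⊆uv z∈xs = ∈-delete u (xs⊆ys (there z∈xs)) (All.lookup x∉xs z∈xs ∘ sym)
  case : ∀ {z} → z ∈ x ∷ u ++ v → z ∈ x ∷ xs
  case (here z≡x) = here z≡x
  case (there z∈) = there (⊆-reverse xs! xs⊆uv
    (ℕ.≤-pred (subst (_≤ suc (length xs)) (↭-length (shift x u v)) ∣ys∣≤∣xs∣)) z∈)

Unique-map⁺ : (f : A → B) {xs : List A} →
              (∀ {x y} → x ∈ xs → y ∈ xs → f x ≡ f y → x ≡ y) →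
              Unique xs → Unique (map f xs)
Unique-map⁺ f inj []           = []
Unique-map⁺ f inj (x∉xs ∷ xs!) =
  All.map⁺ (All.tabulate λ z∈ fx≡fz → All.lookup x∉xs z∈ (inj (here refl) (there z∈) fx≡fz))
  ∷ Unique-map⁺ f (λ x∈ y∈ → inj (there x∈) (there y∈)) xs!

-- Isolated _≺_ u y v says that in the word u y v the letter y is a left-to-right
-- maximum forming a block of its own.

Isolated : Rel A 0ℓ → List A → A → List A → Set
Isolated _≺_ u y v = All (_≺ y) u × All (y ≺_) (take 1 v)

AtIsolated : Rel A 0ℓ → (A → List A → Set) → List A → Set
AtIsolated _≺_ Q w = ∀ u y v → w ≡ u ++ y ∷ v → Isolated _≺_ u y v → Q y v

-- The map π̂ computed in one pass over the word.

-- sweep p c w is the part of π̂ acting on c and w when c w is a suffix of π and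
-- the maximum of π up to c is p.

sweep : Fin n → Fin n → List (Fin n) → Fin n → Fin n
sweep p c []      x with x ≟ c
... | yes _ = p
... | no  _ = x
sweep p c (e ∷ w) x with p <? e | x ≟ c
... | yes _ | yes _ = p
... | yes _ | no  _ = sweep e e w x
... | no  _ | yes _ = e
... | no  _ | no  _ = sweep p e w x

sweep-∈ : ∀ (p c : Fin n) w {x} → x ∈ c ∷ w → sweep p c w x ∈ p ∷ w
sweep-∈ p c []      {x} x∈ with x ≟ c
... | yes _ = here refl
... | no x≢c with here x≡c ← x∈ = contradiction x≡c x≢c
sweep-∈ p c (e ∷ w) {x} x∈ with p <? e | x ≟ c | x∈
... | yes _ | yes _   | _        = here refl
... | no  _ | yes _   | _        = there (here refl)
... | _     | no x≢c  | here x≡c = contradiction x≡c x≢c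
... | yes _ | no  _   | there x∈′ = there (sweep-∈ e e w x∈′)
... | no  _ | no  _   | there x∈′ with sweep-∈ p e w x∈′
...   | here eq = here eq
...   | there ∈w = there (there ∈w)

sweep-∉ : ∀ (p c : Fin n) w {x} → x ∉ c ∷ w → sweep p c w x ≡ x
sweep-∉ p c []      {x} x∉ with x ≟ c
... | yes x≡c = contradiction (here x≡c) x∉
... | no  _   = refl
sweep-∉ p c (e ∷ w) {x} x∉ with p <? e | x ≟ c
... | _     | yes x≡c = contradiction (here x≡c) x∉
... | yes _ | no  _   = sweep-∉ e e w (x∉ ∘ there)
... | no  _ | no  _   = sweep-∉ p e w (x∉ ∘ there)

-- If `e` opens a block, `c` goes to `p` while the letters of `e ∷ w` stay within `e ∷ w`, which
-- omits `p`. Otherwise `c` goes to `e` and the others land in `p ∷ w`, which omits `e`.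
sweep-injective : ∀ (p c : Fin n) w {x y} → Unique (c ∷ w) → p ∉ w →
                  x ∈ c ∷ w → y ∈ c ∷ w → sweep p c w x ≡ sweep p c w y → x ≡ y
sweep-injective p c []      ! p∉ (here x≡c) (here y≡c) _ = trans x≡c (sym y≡c)
sweep-injective p c (e ∷ w) {x} {y} (_ ∷ !) p∉ x∈ y∈ eq
  with p <? e | x ≟ c | y ≟ c | x∈ | y∈
... | _ | yes x≡c | yes y≡c | _ | _ = trans x≡c (sym y≡c)
... | _ | no x≢c | _ | here x≡c | _ = contradiction x≡c x≢c
... | _ | _ | no y≢c | _ | here y≡c = contradiction y≡c y≢c
... | yes _ | yes _ | no _ | _ | there y∈′ =
  contradiction (subst (_∈ _) (sym eq) (sweep-∈ e e w y∈′)) p∉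
... | yes _ | no _ | yes _ | there x∈′ | _ =
  contradiction (subst (_∈ _) eq (sweep-∈ e e w x∈′)) p∉
... | yes _ | no _ | no _ | there x∈′ | there y∈′ =
  sweep-injective e e w ! (head∉tail !) x∈′ y∈′ eq
... | no _ | no _ | no _ | there x∈′ | there y∈′ =
  sweep-injective p e w ! (p∉ ∘ there) x∈′ y∈′ eq
... | no _ | yes _ | no _ | _ | there y∈′ with sweep-∈ p e w y∈′
...   | here eq′ = contradiction (here (sym (trans eq eq′))) p∉
...   | there ∈w = contradiction (subst (_∈ w) (sym eq) ∈w) (head∉tail !)
sweep-injective p c (e ∷ w) {x} {y} (_ ∷ !) p∉ x∈ y∈ eq
    | no _ | no _ | yes _ | there x∈′ | _ with sweep-∈ p e w x∈′
...   | here eq′ = contradiction (here (trans (sym eq′) eq)) p∉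
...   | there ∈w = contradiction (subst (_∈ w) eq ∈w) (head∉tail !)

-- Agreement of the pass with the product of cycles.

product : List (List (Fin n)) → Fin n → Fin n
product = foldr (λ c f → cycle c ∘ f) id

-- What x ↦ x′ can be under a product of cycles supported in w.

Within : List A → A → A → Set
Within w x x′ = x′ ≡ x ⊎ x ∈ w × x′ ∈ w

fixed-by-others : ∀ {w : List A} {c x x′} → c ∉ w → Within w x x′ → x ≡ c → x′ ≡ c
fixed-by-others c∉ (inj₁ x′≡x)    x≡c  = trans x′≡x x≡c
fixed-by-others c∉ (inj₂ (c∈ , _)) refl = contradiction c∈ c∉

only-preimage : ∀ {w : List A} {c x x′} → c ∉ w → Within w x x′ → x′ ≡ c → x ≡ c
only-preimage c∉ (inj₁ x′≡x)    x′≡c = trans (sym x′≡x) x′≡c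
only-preimage c∉ (inj₂ (_ , c∈)) refl = contradiction c∈ c∉

mutual

  -- The product over the blocks of a suffix is itself a `sweep`, whose range is known;
  -- `sweep-blocks` in turn needs this bound on the later cycles.
  laterBlocks : ∀ (p : Fin n) w x → Unique w → Within w x (product (proj₂ (blocksFrom p w)) x)
  laterBlocks p []      x ! = inj₁ refl
  laterBlocks p (e ∷ w) x ! with p <? e
  ... | yes _ rewrite sweep-blocks e e w x ! with DecMembership._∈?_ _≟_ x (e ∷ w)
  ...   | yes x∈ = inj₂ (x∈ , sweep-∈ e e w x∈)
  ...   | no  x∉ = inj₁ (sweep-∉ e e w x∉)
  laterBlocks p (e ∷ w) x (_ ∷ !) | no _ with laterBlocks p w x !
  ...   | inj₁ eq = inj₁ eq
  ...   | inj₂ (x∈w , x′∈w) = inj₂ (there x∈w , there x′∈w)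

  -- The later cycles act first. As `c` is not in `w`, they neither move `c` nor send another letter
  -- to it, so testing for `c` before or after them gives the same answer.
  sweep-blocks : ∀ (p c : Fin n) w x → Unique (c ∷ w) →
    let b , bs = blocksFrom p w in stepFrom p c b (product bs x) ≡ sweep p c w x
  sweep-blocks p c [] x ! with x ≟ c
  ... | yes _ = refl
  ... | no  _ = refl
  sweep-blocks p c (e ∷ w) x !@(_ ∷ !′)
    with c∉ ← head∉tail ! | p <? e | laterBlocks p (e ∷ w) x !′
  ... | yes _ | later
    with product ((e ∷ proj₁ (blocksFrom e w)) ∷ proj₂ (blocksFrom e w)) x ≟ c | x ≟ c
  ...   | yes _    | yes _   = refl
  ...   | yes x′≡c | no x≢c  = contradiction (only-preimage c∉ later x′≡c) x≢c
  ...   | no x′≢c  | yes x≡c = contradiction (fixed-by-others c∉ later x≡c) x′≢c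
  ...   | no _     | no _    = sweep-blocks e e w x !′
  sweep-blocks p c (e ∷ w) x !@(_ ∷ !′) | no _ | later
    with product (proj₂ (blocksFrom p w)) x ≟ c | x ≟ c
  ...   | yes _    | yes _   = refl
  ...   | yes x′≡c | no x≢c  = contradiction (only-preimage c∉ later x′≡c) x≢c
  ...   | no x′≢c  | yes x≡c = contradiction (fixed-by-others c∉ later x≡c) x′≢c
  ...   | no _     | no _    = sweep-blocks p e w x !′

-- The image of a letter in terms of the prefix maximum.

IsMax : Fin n → List (Fin n) → Set
IsMax M w = M ∈ w × All (_≤ᶠ M) w

-- The image under π̂ of the letter just before `v`, when `M` is the maximum up to and including
-- that letter.
overrun : Fin n → List (Fin n) → Fin n
overrun M []      = M
overrun M (z ∷ v) with M <? z
... | yes _ = M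
... | no  _ = z

head-∈ : ∀ {e : A} u {w y v} → e ∷ w ≡ u ++ y ∷ v → e ∈ u ∷ʳ y
head-∈ []      refl = here refl
head-∈ (_ ∷ _) refl = here refl

-- A block starts with the maximum of everything up to any of its letters, so its last letter goes
-- back to `M` and any other letter to its successor. Earlier letters of the word enter only through
-- their maximum `p`.
sweep-at : ∀ (p c : Fin n) w u {y v} → Unique (c ∷ w) → c ≤ᶠ p → c ∷ w ≡ u ++ y ∷ v →
           ∃[ M ] IsMax M (p ∷ u ∷ʳ y) × sweep p c w y ≡ overrun M v
sweep-at p c w [] {y} {v} ! c≤p refl = p , (here refl , Fin.≤-refl ∷ c≤p ∷ []) , eq v
  where
  eq : ∀ v → sweep p y v y ≡ overrun p v
  eq [] with y ≟ y
  ... | yes _  = refl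
  ... | no y≢y = contradiction refl y≢y
  eq (z ∷ v) with p <? z | y ≟ y
  ... | _     | no y≢y = contradiction refl y≢y
  ... | yes _ | yes _  = refl
  ... | no _  | yes _  = refl
sweep-at p c []      (_ ∷ [])      ! c≤p ()
sweep-at p c []      (_ ∷ (_ ∷ _)) ! c≤p ()
sweep-at p c (e ∷ w) (_ ∷ u) {y} !@(c∉ ∷ !′) c≤p refl′ with ∷-injective refl′
... | refl , eq with p <? e | y ≟ c
...   | _ | yes refl = contradiction (subst (y ∈_) (sym eq) (∈-insert u)) (head∉tail !)
-- The new running maximum `e` is also the first letter of what remains of `u ∷ʳ y`, so `absorb` can
-- drop the extra copy.
...   | yes p<e | no _ with sweep-at e e w u !′ Fin.≤-refl eq
...     | M , (M∈ , e≤M ∷ ≤M) , q =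
  M , (there (there (absorb M∈)) , p≤M ∷ ℕ.≤-trans c≤p p≤M ∷ ≤M) , q
  where
  p≤M : p ≤ᶠ M
  p≤M = ℕ.≤-trans (ℕ.<⇒≤ p<e) e≤M
  absorb : ∀ {z} → z ∈ e ∷ u ∷ʳ y → z ∈ u ∷ʳ y
  absorb (here refl) = head-∈ u eq
  absorb (there z∈)  = z∈
sweep-at p c (e ∷ w) (_ ∷ u) {y} (_ ∷ !′) c≤p refl′ | refl , eq | no p≮e | no _
  with sweep-at p e w u !′ (ℕ.≮⇒≥ p≮e) eq
... | M , (here M≡p , p≤M ∷ ≤M) , q =
  M , (here M≡p , p≤M ∷ ℕ.≤-trans c≤p p≤M ∷ ≤M) , q
... | M , (there M∈ , p≤M ∷ ≤M) , q =
  M , (there (there M∈) , p≤M ∷ ℕ.≤-trans c≤p p≤M ∷ ≤M) , q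

cycles : List (Fin n) → Fin n → Fin n
cycles = product ∘ blocks

cycles-at : ∀ {w : List (Fin n)} u {y v} → Unique w → w ≡ u ++ y ∷ v →
            ∃[ M ] IsMax M (u ∷ʳ y) × cycles w y ≡ overrun M v
cycles-at {w = []}    []      ! ()
cycles-at {w = c ∷ w} u {y} ! eq with sweep-at c c w u ! Fin.≤-refl eq
... | M , (M∈ , _ ∷ ≤M) , q = M , (absorb M∈ , ≤M) , trans (sweep-blocks c c w y !) q
  where
  absorb : ∀ {z} → z ∈ c ∷ u ∷ʳ y → z ∈ u ∷ʳ y
  absorb (here refl) = head-∈ u eq
  absorb (there z∈)  = z∈

cycles-injective : ∀ {w : List (Fin n)} → Unique w → (∀ x → x ∈ w) →
                   ∀ {x y} → cycles w x ≡ cycles w y → x ≡ y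
cycles-injective {w = []}    !  all∈ eq = eq
cycles-injective {w = c ∷ w} ! all∈ {x} {y} eq =
  sweep-injective c c w ! (head∉tail !) (all∈ x) (all∈ y)
    (trans (sym (sweep-blocks c c w x !)) (trans eq (sweep-blocks c c w y !)))

-- Fixed points of π̂ are the isolated letters.

module _ (u : List (Fin n)) {w : List (Fin n)} {y v} (! : Unique w) (w≡ : w ≡ u ++ y ∷ v) where

  private
    y∉u : y ∉ u
    y∉u = Unique⇒∉ˡ u (subst Unique w≡ !)
    y∉v : y ∉ v
    y∉v = Unique⇒∉ʳ u (subst Unique w≡ !)

  -- The image of `y` is either the next letter, which differs from `y`, or the prefix maximum `M`.
  -- So `y` is `M`, and its block ends with it.
  fixed⇒isolated : cycles w y ≡ y → Isolated _<ᶠ_ u y v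
  fixed⇒isolated fixed with cycles-at u ! w≡
  ... | M , (_ , ≤M) , q = decide v y∉v (trans (sym q) fixed)
    where
    below : M ≡ y → All (_<ᶠ y) u
    below refl = All.tabulate λ z∈ → Fin.≤∧≢⇒< (All.lookup ≤M (∈-++⁺ˡ z∈)) (∈∧∉⇒≢ z∈)
      where
      ∈∧∉⇒≢ : ∀ {z} → z ∈ u → z ≢ y
      ∈∧∉⇒≢ z∈ refl = y∉u z∈
    decide : ∀ v → y ∉ v → overrun M v ≡ y → Isolated _<ᶠ_ u y v
    decide []      y∉ M≡y = below M≡y , []
    decide (z ∷ v) y∉ eq with M <? z
    ... | yes M<z = below eq , subst (_<ᶠ z) eq M<z ∷ []
    ... | no  _   = contradiction (here (sym eq)) y∉

  isolated⇒fixed : Isolated _<ᶠ_ u y v → cycles w y ≡ y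
  isolated⇒fixed (u<y , y<v) with cycles-at u ! w≡
  ... | M , (M∈ , ≤M) , q = trans q (trans (cong (λ M → overrun M v) M≡y) (stays v y<v))
    where
    M≡y : M ≡ y
    M≡y with ∈-++⁻ u M∈
    ... | inj₂ (here eq) = eq
    ... | inj₁ M∈u =
      contradiction (All.lookup u<y M∈u) (ℕ.≤⇒≯ (All.lookup ≤M (∈-insert u)))
    stays : ∀ v → All (y <ᶠ_) (take 1 v) → overrun y v ≡ y
    stays []      []        = refl
    stays (z ∷ v) (y<z ∷ _) with y <? z
    ... | yes _  = refl
    ... | no y≮z = contradiction y<z y≮z

-- Recovering a word from its π̂.

IsMax-unique : ∀ {M M′ : Fin n} {u u′} → u ⊆ u′ → u′ ⊆ u → IsMax M u → IsMax M′ u′ → M ≡ M′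
IsMax-unique u⊆u′ u′⊆u (M∈u , u≤M) (M′∈u′ , u′≤M′) =
  Fin.≤-antisym (All.lookup u′≤M′ (u⊆u′ M∈u)) (All.lookup u≤M (u′⊆u M′∈u′))

prefix-⊆ : ∀ (u u′ : List A) {v} → Unique (u ++ v) → (∀ {x} → x ∈ u → x ∈ u′ ++ v) → u ⊆ u′
prefix-⊆ u u′ ! u⊆ x∈u with ∈-++⁻ u′ (u⊆ x∈u)
... | inj₁ x∈u′ = x∈u′
... | inj₂ x∈v  =
  contradiction refl (All.lookup (All.lookup (proj₂ (proj₂ (AllPairs-++⁻ u !))) x∈u) x∈v)

-- Words are compared from the right: the last letters of two prefixes u and u′
-- followed by the same v have the same image, hence they are equal.

cycles-determines : ∀ {w w′ : List (Fin n)} → Unique w → Unique w′ →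
  (∀ x → x ∈ w) → (∀ x → x ∈ w′) → cycles w ≗ cycles w′ →
  ∀ {u u′} v → Reverse u → Reverse u′ → w ≡ u ++ v → w′ ≡ u′ ++ v → w ≡ w′
cycles-determines ! !′ ∈w ∈w′ hat≗ v [] [] refl refl = refl
-- With one prefix empty, `v` already holds every letter, so the other word would repeat one.
cycles-determines {w′ = w′} ! !′ ∈w ∈w′ hat≗ v [] (u′ ∶ _ ∶ʳ y′) refl refl =
  contradiction (∈w y′) (Unique⇒∉ʳ u′ (subst Unique (++-assoc u′ [ y′ ] v) !′))
cycles-determines ! !′ ∈w ∈w′ hat≗ v (u ∶ _ ∶ʳ y) [] refl refl =
  contradiction (∈w′ y) (Unique⇒∉ʳ u (subst Unique (++-assoc u [ y ] v) !))
cycles-determines {w = w} {w′} ! !′ ∈w ∈w′ hat≗ v (u ∶ ru ∶ʳ y) (u′ ∶ ru′ ∶ʳ y′) w≡ w′≡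
  with cycles-at u {y} {v} ! (trans w≡ (++-assoc u [ y ] v))
     | cycles-at u′ {y′} {v} !′ (trans w′≡ (++-assoc u′ [ y′ ] v))
... | M , isMax , eq | M′ , isMax′ , eq′ = finish y≡y′ w≡ w′≡
  where
  -- Both prefixes consist of exactly the letters missing from `v`, hence have the same maximum.
  M≡M′ : M ≡ M′
  M≡M′ = IsMax-unique
    (prefix-⊆ (u ∷ʳ y) (u′ ∷ʳ y′) (subst Unique w≡ !) (λ {x} _ → subst (x ∈_) w′≡ (∈w′ x)))
    (prefix-⊆ (u′ ∷ʳ y′) (u ∷ʳ y) (subst Unique w′≡ !′) (λ {x} _ → subst (x ∈_) w≡ (∈w x)))
    isMax isMax′
  y≡y′ : y ≡ y′
  y≡y′ = cycles-injective ! ∈w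
    (trans eq (trans (cong (λ M → overrun M v) M≡M′) (trans (sym eq′) (sym (hat≗ y′)))))
  finish : ∀ {z z′} → z ≡ z′ → w ≡ (u ∷ʳ z) ++ v → w′ ≡ (u′ ∷ʳ z′) ++ v → w ≡ w′
  finish {z} refl w≡ w′≡ = cycles-determines ! !′ ∈w ∈w′ hat≗ (z ∷ v) ru ru′
    (trans w≡ (++-assoc u [ z ] v)) (trans w′≡ (++-assoc u′ [ z ] v))

-- Permutations as duplicate-free vectors.

toList-Unique⁺ : {xs : Vec A n} → Vec.Unique xs → Unique (toList xs)
toList-Unique⁺ VecAllPairs.[]       = []
toList-Unique⁺ (p VecAllPairs.∷ ps) = VecAll.toList⁺ p ∷ toList-Unique⁺ ps

toList-Unique⁻ : {xs : Vec A n} → Unique (toList xs) → Vec.Unique xs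
toList-Unique⁻ {xs = []}    []       = VecAllPairs.[]
toList-Unique⁻ {xs = _ ∷ _} (p ∷ ps) = VecAll.toList⁻ p VecAllPairs.∷ toList-Unique⁻ ps

toList-injective : {xs ys : Vec A n} → toList xs ≡ toList ys → xs ≡ ys
toList-injective {xs = xs} eq =
  trans (sym (Vec.cast-is-id refl xs)) (Vec.toList-injective refl _ _ eq)

∈-words : (π : Vec (Fin n) m) → π ∈ words m n
∈-words []      = here refl
∈-words (i ∷ π) = ∈-cartesianProductWith⁺ _∷_ (∈-allFin i) (∈-words π)

words-Unique : ∀ m n → Unique (words m n)
words-Unique zero    n = [] ∷ []
words-Unique (suc m) n =
  Unique.cartesianProductWith⁺ _∷_ Vec.∷-injective (Unique.allFin⁺ n) (words-Unique m n)

private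
  unique? : Decidable (Vec.Unique {A = Fin n} {n})
  unique? = VecAllPairs.allPairs? λ i j → ¬? (i ≟ j)

∈-permutations⁺ : {π : Vec (Fin n) n} → Unique (toList π) → π ∈ permutations n
∈-permutations⁺ ! = ∈-filter⁺ unique? (∈-words _) (toList-Unique⁻ !)

∈-permutations⁻ : {π : Vec (Fin n) n} → π ∈ permutations n → Unique (toList π)
∈-permutations⁻ π∈ = toList-Unique⁺ (proj₂ (∈-filter⁻ unique? {xs = words _ _} π∈))

permutations-Unique : ∀ n → Unique (permutations n)
permutations-Unique n = Unique.filter⁺ unique? (words-Unique n n)

-- A duplicate-free word of length `n` over `n` letters uses them all, by pigeonhole.
∈-permutation : {π : Vec (Fin n) n} → Unique (toList π) → ∀ x → x ∈ toList π
∈-permutation {π = π} ! x = ⊆-reverse ! (λ _ → ∈-allFin _)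
  (ℕ.≤-reflexive (trans (length-tabulate id) (sym (Vec.length-toList π)))) (∈-allFin x)

-- Foata's fundamental transformation and derangements.

foata : Vec (Fin n) n → Vec (Fin n) n
foata π = tabulate (hat π)

foata∈permutations : {π : Vec (Fin n) n} → π ∈ permutations n → foata π ∈ permutations n
foata∈permutations π∈ = ∈-permutations⁺ (toList-Unique⁺ (Vec.tabulate⁺
  (cycles-injective ! (∈-permutation !))))
  where ! = ∈-permutations⁻ π∈

foata-injective : {π ρ : Vec (Fin n) n} → π ∈ permutations n → ρ ∈ permutations n →
                  foata π ≡ foata ρ → π ≡ ρ
foata-injective {π = π} {ρ} π∈ ρ∈ eq = toList-injective
  (cycles-determines ! !′ (∈-permutation !) (∈-permutation !′) hat≗ []
    (reverseView (toList π)) (reverseView (toList ρ)) (sym (++-identityʳ _)) (sym (++-identityʳ _)))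
  where
  ! = ∈-permutations⁻ π∈
  !′ = ∈-permutations⁻ ρ∈
  hat≗ : hat π ≗ hat ρ
  hat≗ i = trans (sym (Vec.lookup∘tabulate (hat π) i))
    (trans (cong (λ v → lookup v i) eq) (Vec.lookup∘tabulate (hat ρ) i))

HatFixedPointFree : Vec (Fin n) n → Set
HatFixedPointFree π = ∀ i → hat π i ≢ i

hatFixedPointFree? : Decidable (HatFixedPointFree {n})
hatFixedPointFree? π = all? λ i → ¬? (hat π i ≟ i)

foata-surjective : ∀ n → permutations n ⊆ map foata (permutations n)
foata-surjective n = ⊆-reverse
    (Unique-map⁺ foata foata-injective (permutations-Unique n)) into
    (ℕ.≤-reflexive (sym (length-map foata (permutations n))))
  where
  into : map foata (permutations n) ⊆ permutations n
  into ρ∈ with ∈-map⁻ foata ρ∈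
  ... | π , π∈ , refl = foata∈permutations π∈

-- The bijection `foata` carries the words whose π̂ has no fixed point onto the derangements; each
-- inclusion gives one inequality.
count-hatFixedPointFree : ∀ n → length (filter hatFixedPointFree? (permutations n)) ≡ d n
count-hatFixedPointFree n = ℕ.≤-antisym
  (subst (_≤ d n) (length-map foata H) (length-⊆
    (Unique-map⁺ foata (λ π∈ ρ∈ → foata-injective (proj₁ (∈H⁻ π∈)) (proj₁ (∈H⁻ ρ∈)))
      (Unique.filter⁺ hatFixedPointFree? (permutations-Unique n)))
    into))
  (subst (d n ≤_) (length-map foata H) (length-⊆
    (Unique.filter⁺ fixedPointFree? (permutations-Unique n)) onto))
  where
  H = filter hatFixedPointFree? (permutations n)
  ∈H⁻ : ∀ {π} → π ∈ H → π ∈ permutations n × HatFixedPointFree π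
  ∈H⁻ = ∈-filter⁻ hatFixedPointFree? {xs = permutations n}
  into : map foata H ⊆ filter fixedPointFree? (permutations n)
  into ρ∈ with ∈-map⁻ foata ρ∈
  ... | π , π∈ , refl = ∈-filter⁺ fixedPointFree? (foata∈permutations (proj₁ (∈H⁻ π∈)))
    λ i eq → proj₂ (∈H⁻ π∈) i (trans (sym (Vec.lookup∘tabulate (hat π) i)) eq)
  onto : filter fixedPointFree? (permutations n) ⊆ map foata H
  onto ρ∈ with ∈-filter⁻ fixedPointFree? {xs = permutations n} ρ∈
  ... | ρ∈′ , free with ∈-map⁻ foata (foata-surjective n ρ∈′)
  ...   | π , π∈ , refl = ∈-map⁺ foata (∈-filter⁺ hatFixedPointFree? π∈
    λ i eq → free i (trans (Vec.lookup∘tabulate (hat π) i) eq))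

-- Derangement and avoidance as conditions at isolated letters.

module _ {π : Vec (Fin n) n} (! : Unique (toList π)) where

  hatFixedPointFree⁺ : AtIsolated _<ᶠ_ (λ _ _ → ⊥) (toList π) → HatFixedPointFree π
  hatFixedPointFree⁺ none i eq with ∈-∃++ (∈-permutation ! i)
  ... | u , v , w≡ = none u i v w≡ (fixed⇒isolated u ! w≡ eq)

  hatFixedPointFree⁻ : HatFixedPointFree π → AtIsolated _<ᶠ_ (λ _ _ → ⊥) (toList π)
  hatFixedPointFree⁻ free u y v w≡ iso = free y (isolated⇒fixed u ! w≡ iso)

∈-toList⇒lookup : (xs : Vec A n) → ∀ {z} → z ∈ toList xs → ∃[ j ] lookup xs j ≡ z
∈-toList⇒lookup (x ∷ xs) (here z≡x) = zero , sym z≡x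
∈-toList⇒lookup (x ∷ xs) (there z∈) with ∈-toList⇒lookup xs z∈
... | j , eq = suc j , eq

lookup-after : ∀ (xs : Vec A n) u {h v z} → toList xs ≡ u ++ h ∷ v → z ∈ v →
               ∃₂ λ i j → i <ᶠ j × lookup xs i ≡ h × lookup xs j ≡ z
lookup-after []       []      ()
lookup-after []       (_ ∷ _) ()
lookup-after (x ∷ xs) []      refl z∈v with ∈-toList⇒lookup xs z∈v
... | j , eq = zero , suc j , z<s , refl , eq
lookup-after (x ∷ xs) (_ ∷ u) eq   z∈v with lookup-after xs u (proj₂ (∷-injective eq)) z∈v
... | i , j , i<j , eq₁ , eq₂ = suc i , suc j , s<s i<j , eq₁ , eq₂

-- A position holding a letter above `y` lies neither in `u` nor at `y`, so it lies in `v`, and so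
-- does every later position.
stays-above : ∀ (xs : Vec (Fin n) m) u {y v i j} → toList xs ≡ u ++ y ∷ v →
              All (_<ᶠ y) u → All (y <ᶠ_) v → i <ᶠ j → y <ᶠ lookup xs i → y <ᶠ lookup xs j
stays-above []       []      ()
stays-above []       (_ ∷ _) ()
stays-above (x ∷ xs) [] {i = zero}  refl u<y y<v i<j y<y = contradiction y<y (ℕ.<-irrefl refl)
stays-above (x ∷ xs) [] {i = suc _} {suc j} refl u<y y<v i<j _ =
  All.lookup y<v (∈-lookup xs j)
  where
  ∈-lookup : ∀ {k} (xs : Vec A k) j → lookup xs j ∈ toList xs
  ∈-lookup xs j = Vec.∈-toList⁺ (Vec.∈-lookup j xs)
stays-above (x ∷ xs) (_ ∷ u) {i = zero}  {suc j} eq (c<y ∷ _) y<v i<j y<x =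
  contradiction (subst (_<ᶠ _) (sym (proj₁ (∷-injective eq))) c<y) (ℕ.<-asym y<x)
stays-above (x ∷ xs) (_ ∷ u) {i = suc i} {suc j} eq (_ ∷ u<y) y<v (s<s i<j) y<xᵢ =
  stays-above xs u (proj₂ (∷-injective eq)) u<y y<v i<j y<xᵢ

module _ {π : Vec (Fin n) n} (! : Unique (toList π)) where

  -- In an occurrence the letter `x₂` is fixed, hence isolated. The larger `x₃` must come after it,
  -- so `x₁` does too, and would have to exceed `x₂`.
  avoids⁺ : AtIsolated _<ᶠ_ (λ y v → All (y <ᶠ_) v) (toList π) → Avoids pattern31∣2→2 π
  avoids⁺ strong ((x₁ ∷ x₂ ∷ x₃ ∷ []) , (i ∷ j ∷ []) ,
    ((x₁<x₂ VecAll.∷ _) VecAllPairs.∷ (x₂<x₃ VecAll.∷ _) VecAllPairs.∷ _) ,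
    ((i<j VecAll.∷ _) VecAllPairs.∷ _) , eq , (fixed ∷ _))
    with ∈-∃++ (∈-permutation ! x₂)
  ... | u , v , w≡ = ℕ.<-asym x₁<x₂
    (subst (x₂ <ᶠ_) (proj₁ (Vec.∷-injective (proj₂ (Vec.∷-injective eq))))
      (stays-above π u w≡ (proj₁ iso) (strong u x₂ v w≡ iso) i<j
        (subst (x₂ <ᶠ_) (sym (proj₁ (Vec.∷-injective eq))) x₂<x₃)))
    where
    iso : Isolated _<ᶠ_ u x₂ v
    iso = fixed⇒isolated u ! w≡ fixed

  -- A letter `z` of `v` below `y` would follow the first letter `h`, which is above `y`; then `h`
  -- and `z` play 3 and 1 around the fixed letter `y`.
  avoids⁻ : Avoids pattern31∣2→2 π → AtIsolated _<ᶠ_ (λ y v → All (y <ᶠ_) v) (toList π)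
  avoids⁻ avoids u y []      w≡ iso = []
  avoids⁻ avoids u y (h ∷ v) w≡ iso@(_ , y<h ∷ _) = y<h ∷ All.tabulate above
    where
    above : ∀ {z} → z ∈ v → y <ᶠ z
    above {z} z∈v with Fin.<-cmp y z
    ... | tri< y<z _ _ = y<z
    ... | tri≈ _ refl _ = contradiction (there z∈v) (Unique⇒∉ʳ u (subst Unique w≡ !))
    ... | tri> _ _ z<y
      with i , j , i<j , eq₁ , eq₂ ←
        lookup-after π (u ∷ʳ y) (trans w≡ (sym (++-assoc u [ y ] (h ∷ v)))) z∈v
      = contradiction
      ( (z ∷ y ∷ h ∷ []) , (i ∷ j ∷ [])
      , (z<y VecAll.∷ ℕ.<-trans z<y y<h VecAll.∷ VecAll.[])
        VecAllPairs.∷ (y<h VecAll.∷ VecAll.[]) VecAllPairs.∷ VecAll.[] VecAllPairs.∷ VecAllPairs.[]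
      , (i<j VecAll.∷ VecAll.[]) VecAllPairs.∷ VecAll.[] VecAllPairs.∷ VecAllPairs.[]
      , cong₂ (λ a b → a ∷ b ∷ []) eq₁ eq₂
      , isolated⇒fixed u ! w≡ iso ∷ [] ) avoids

-- Comparing two cuts of a word, and transport along order embeddings.

data Split {A : Set} (u : List A) (x : A) (v : List A) : List A → A → List A → Set where
  left   : ∀ {u′ y} s → u ≡ u′ ++ y ∷ s → Split u x v u′ y (s ++ x ∷ v)
  middle : Split u x v u x v
  right  : ∀ {y v′} s → v ≡ s ++ y ∷ v′ → Split u x v (u ++ x ∷ s) y v′

split : ∀ (u : List A) {x v} u′ {y v′} → u ++ x ∷ v ≡ u′ ++ y ∷ v′ → Split u x v u′ y v′
split []      []       refl = middle
split []      (_ ∷ u′) refl = right u′ refl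
split (_ ∷ u) []       refl = left u refl
split (c ∷ u) (c′ ∷ u′) eq with ∷-injective eq
... | refl , eq′ with split u u′ eq′
...   | left s refl  = left s refl
...   | middle       = middle
...   | right s refl = right s refl

map-split : (f : A → B) → ∀ w u {y v} → map f w ≡ u ++ y ∷ v →
            ∃[ u₀ ] ∃[ y₀ ] ∃[ v₀ ] w ≡ u₀ ++ y₀ ∷ v₀ × u ≡ map f u₀ × y ≡ f y₀ × v ≡ map f v₀
map-split f []      []      ()
map-split f []      (_ ∷ _) ()
map-split f (x ∷ w) []      refl = [] , x , w , refl , refl , refl , refl
map-split f (x ∷ w) (c ∷ u) eq with ∷-injective eq
... | refl , eq′ with map-split f w u eq′
...   | u₀ , y₀ , v₀ , refl , refl , refl , refl = x ∷ u₀ , y₀ , v₀ , refl , refl , refl , refl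

module _ {_<₁_ : Rel A 0ℓ} {_<₂_ : Rel B 0ℓ} {Q₁ : A → List A → Set} {Q₂ : B → List B → Set}
         (f : A → B) {w : List A} where

  -- Isolation is a hypothesis inside `AtIsolated`, so going forward needs `f` to reflect the order,
  -- and going back needs `f` to preserve it.
  AtIsolated-map⁺ : (∀ {x y} → f x <₂ f y → x <₁ y) → (∀ {y v} → Q₁ y v → Q₂ (f y) (map f v)) →
                    AtIsolated _<₁_ Q₁ w → AtIsolated _<₂_ Q₂ (map f w)
  AtIsolated-map⁺ reflects Q₁⇒Q₂ at u y v w≡ iso with map-split f w u w≡
  ... | u₀ , y₀ , v₀ , eq , refl , refl , refl = Q₁⇒Q₂ (at u₀ y₀ v₀ eq
    (All.map reflects (All.map⁻ (proj₁ iso)) , head v₀ (proj₂ iso)))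
    where
    head : ∀ v → All (f y₀ <₂_) (take 1 (map f v)) → All (y₀ <₁_) (take 1 v)
    head []      []      = []
    head (_ ∷ _) (p ∷ _) = reflects p ∷ []

  AtIsolated-map⁻ : (∀ {x y} → x <₁ y → f x <₂ f y) → (∀ {y v} → Q₂ (f y) (map f v) → Q₁ y v) →
                    AtIsolated _<₂_ Q₂ (map f w) → AtIsolated _<₁_ Q₁ w
  AtIsolated-map⁻ preserves Q₂⇒Q₁ at u y v refl iso = Q₂⇒Q₁ (at (map f u) (f y) (map f v)
    (map-++ f u (y ∷ v)) (All.map⁺ (All.map preserves (proj₁ iso)) , head v (proj₂ iso)))
    where
    head : ∀ v → All (y <₁_) (take 1 v) → All (f y <₂_) (take 1 (map f v))
    head []      []      = []
    head (_ ∷ _) (p ∷ _) = preserves p ∷ []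

-- Avoiders and derangements as words over ℕ.

IsPermutation : ℕ → List ℕ → Set
IsPermutation n w = Unique w × All (_< n) w × length w ≡ n

Strong Deranged : List ℕ → Set
Strong   = AtIsolated _<_ λ y v → All (y <_) v
Deranged = AtIsolated _<_ λ y v → ⊥

-- Letters in ℕ instead of `Fin n` let pieces over different alphabets be cut, shifted and joined
-- within one type.
word : Vec (Fin n) m → List ℕ
word = map toℕ ∘ toList

word-injective : {π ρ : Vec (Fin n) m} → word π ≡ word ρ → π ≡ ρ
word-injective = toList-injective ∘ map-injective toℕ-injective

word-surjective : ∀ {w} → All (_< n) w → length w ≡ m → ∃[ π ] word {n} {m} π ≡ w
word-surjective             []         refl = [] , refl
word-surjective {m = suc m} (x<n ∷ <n) len with word-surjective <n (ℕ.suc-injective len)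
... | π , refl = fromℕ< x<n ∷ π , cong (_∷ _) (toℕ-fromℕ< x<n)

module _ {P : Vec (Fin n) n → Set} (P? : Decidable P) where

  wordsWith : List (List ℕ)
  wordsWith = map word (filter P? (permutations n))

  wordsWith-Unique : Unique wordsWith
  wordsWith-Unique = Unique.map⁺ word-injective (Unique.filter⁺ P? (permutations-Unique n))

  ∈-wordsWith⁺ : ∀ {w} → IsPermutation n w → (∀ {π} → Unique (toList π) → w ≡ word π → P π) →
                 w ∈ wordsWith
  ∈-wordsWith⁺ (! , <n , len) p with word-surjective <n len
  ... | π , refl = ∈-map⁺ word (∈-filter⁺ P? (∈-permutations⁺ !π) (p !π refl))
    where !π = Unique.map⁻ !

  ∈-wordsWith⁻ : ∀ {w} → w ∈ wordsWith →
                 IsPermutation n w × ∃[ π ] Unique (toList π) × w ≡ word π × P π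
  ∈-wordsWith⁻ w∈ with ∈-map⁻ word w∈
  ... | π , π∈ , refl with ∈-filter⁻ P? {xs = permutations n} π∈
  ...   | π∈′ , p = (Unique.map⁺ toℕ-injective ! , All.map⁺ (All.universal toℕ<n _)
      , trans (length-map toℕ (toList π)) (Vec.length-toList π)) , π , ! , refl , p
    where ! = ∈-permutations⁻ π∈′

opaque

  strongWords derangedWords : ℕ → List (List ℕ)
  strongWords n = wordsWith (avoids? {n = n} pattern31∣2→2)
  derangedWords n = wordsWith (hatFixedPointFree? {n})

  ∈-strongWords⁺ : ∀ {w} → IsPermutation n w → Strong w → w ∈ strongWords n
  ∈-strongWords⁺ {n} perm strong = ∈-wordsWith⁺ (avoids? {n = n} pattern31∣2→2) perm λ where
    ! refl → avoids⁺ ! (AtIsolated-map⁻ toℕ id All.map⁻ strong)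

  ∈-strongWords⁻ : ∀ {w} → w ∈ strongWords n → IsPermutation n w × Strong w
  ∈-strongWords⁻ {n} w∈ with ∈-wordsWith⁻ (avoids? {n = n} pattern31∣2→2) w∈
  ... | perm , π , ! , refl , p = perm , AtIsolated-map⁺ toℕ id All.map⁺ (avoids⁻ ! p)

  ∈-derangedWords⁺ : ∀ {w} → IsPermutation n w → Deranged w → w ∈ derangedWords n
  ∈-derangedWords⁺ {n} perm deranged = ∈-wordsWith⁺ (hatFixedPointFree? {n}) perm λ where
    ! refl → hatFixedPointFree⁺ ! (AtIsolated-map⁻ toℕ id id deranged)

  ∈-derangedWords⁻ : ∀ {w} → w ∈ derangedWords n → IsPermutation n w × Deranged w
  ∈-derangedWords⁻ {n} w∈ with ∈-wordsWith⁻ (hatFixedPointFree? {n}) w∈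
  ... | perm , π , ! , refl , p = perm , AtIsolated-map⁺ toℕ id id (hatFixedPointFree⁻ ! p)

  length-strongWords : ∀ n → length (strongWords n) ≡ a n
  -- The convention for `a 0` agrees with the count: the empty word is an avoider.
  length-strongWords zero      = refl
  length-strongWords n@(suc _) = length-map word (avoiders n pattern31∣2→2)

  length-derangedWords : ∀ n → length (derangedWords n) ≡ d n
  length-derangedWords n = trans
    (length-map word (filter hatFixedPointFree? (permutations n))) (count-hatFixedPointFree n)

  strongWords-Unique : ∀ n → Unique (strongWords n)
  strongWords-Unique n = wordsWith-Unique (avoids? {n = n} pattern31∣2→2)

  derangedWords-Unique : ∀ n → Unique (derangedWords n)
  derangedWords-Unique n = wordsWith-Unique (hatFixedPointFree? {n})

-- Finding the last isolated letter.

NoneIsolatedFrom : List ℕ → List ℕ → Set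
NoneIsolatedFrom u v = ∀ u′ y v′ → v ≡ u′ ++ y ∷ v′ → ¬ Isolated _<_ (u ++ u′) y v′

isolated? : ∀ u y v → Dec (Isolated _<_ u y v)
isolated? u y v = All.all? (ℕ._<? y) u ×-dec All.all? (y ℕ.<?_) (take 1 v)

-- The letter `z` is tested only after the rest of `v` yields nothing, so the letter found is the
-- last one. Isolation always refers to the whole word, hence the accumulated prefix `u`.
lastIsolated : ∀ u v → NoneIsolatedFrom u v ⊎
  ∃[ u′ ] ∃[ y ] ∃[ v′ ]
    u ++ v ≡ u′ ++ y ∷ v′ × Isolated _<_ u′ y v′ × NoneIsolatedFrom (u′ ∷ʳ y) v′
lastIsolated u []      = inj₁ λ { [] _ _ () ; (_ ∷ _) _ _ () }
lastIsolated u (z ∷ v) with lastIsolated (u ∷ʳ z) v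
... | inj₂ (u′ , y , v′ , eq , rest) =
  inj₂ (u′ , y , v′ , trans (sym (++-assoc u [ z ] v)) eq , rest)
... | inj₁ none with isolated? u z v
...   | yes iso = inj₂ (u , z , v , refl , iso , none)
...   | no ¬iso = inj₁ λ where
  []       y v′ refl → ¬iso ∘ subst (λ u → Isolated _<_ u z v) (++-identityʳ u)
  (_ ∷ u′) y v′ refl →
    none u′ y v′ refl ∘ subst (λ u → Isolated _<_ u y v′) (sym (++-assoc u [ z ] u′))

-- Gluing, and counting the triples.

-- A triple (m , τ , σ) encodes a strong word σ m τ⁺ whose last isolated letter
-- is m, where τ⁺ is τ shifted above m.

raise : ℕ → List ℕ → List ℕ
raise m = map (suc m +_)

glue : ℕ × List ℕ × List ℕ → List ℕ
glue (m , τ , σ) = σ ++ m ∷ raise m τ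

raise-above : ∀ m τ → All (m <_) (raise m τ)
raise-above m τ = All.map⁺ (All.universal (ℕ.m≤m+n (suc m)) τ)

raise-Deranged⁺ : ∀ m {τ} → Deranged τ → Deranged (raise m τ)
raise-Deranged⁺ m = AtIsolated-map⁺ (suc m +_) (ℕ.+-cancelˡ-< (suc m) _ _) id

raise-Deranged⁻ : ∀ m {τ} → Deranged (raise m τ) → Deranged τ
raise-Deranged⁻ m = AtIsolated-map⁻ (suc m +_) (ℕ.+-monoʳ-< (suc m)) id

raise-∸ : ∀ m {v} → All (m <_) v → raise m (map (_∸ suc m) v) ≡ v
raise-∸ m {v} m<v = trans (sym (map-∘ v)) (map-id-local (All.map ℕ.m+[n∸m]≡n m<v))

-- Letters start at 0, so `m` of them lie below `m` and `n ∸ suc m` above.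
triples : ℕ → List (ℕ × List ℕ × List ℕ)
triples n = concatMap
  (λ m → map (m ,_) (cartesianProduct (derangedWords (n ∸ suc m)) (strongWords m))) (upTo n)

∈-triples⁺ : ∀ {m τ σ} → m < n → τ ∈ derangedWords (n ∸ suc m) → σ ∈ strongWords m →
             (m , τ , σ) ∈ triples n
∈-triples⁺ m<n τ∈ σ∈ = ∈-concatMap⁺ _ (lose (∈-upTo⁺ m<n) (∈-map⁺ _ (∈-cartesianProduct⁺ τ∈ σ∈)))

∈-triples⁻ : ∀ n {m τ σ} → (m , τ , σ) ∈ triples n →
             m < n × τ ∈ derangedWords (n ∸ suc m) × σ ∈ strongWords m
∈-triples⁻ n t∈ with find (∈-concatMap⁻ _ {xs = upTo n} t∈)
... | m , m∈ , t∈m with ∈-map⁻ (m ,_) t∈m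
...   | _ , τσ∈ , refl =
  ∈-upTo⁻ m∈ , ∈-cartesianProduct⁻ (derangedWords (n ∸ suc m)) (strongWords m) τσ∈

triples-Unique : ∀ n → Unique (triples n)
triples-Unique n = Unique.concat⁺
  (All.map⁺ (All.universal (λ m → Unique.map⁺ ,-injectiveʳ (Unique.cartesianProduct⁺
    (derangedWords-Unique (n ∸ suc m)) (strongWords-Unique m))) _))
  (AllPairs.map⁺ (AllPairs.map disjoint (Unique.upTo⁺ n)))
  where
  disjoint : ∀ {m m′} {xs ys : List (List ℕ × List ℕ)} → m ≢ m′ →
             Disjoint (map (m ,_) xs) (map (m′ ,_) ys)
  disjoint m≢m′ (t∈ , t∈′) with ∈-map⁻ _ t∈ | ∈-map⁻ _ t∈′
  ... | _ , _ , refl | _ , _ , eq = m≢m′ (,-injectiveˡ eq)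

length-concatMap : (f : A → List B) → ∀ xs → length (concatMap f xs) ≡ sum (map (length ∘ f) xs)
length-concatMap f []       = refl
length-concatMap f (x ∷ xs) = trans (length-++ (f x)) (cong (length (f x) +_) (length-concatMap f xs))

length-cartesianProduct : (xs : List A) (ys : List B) →
                          length (cartesianProduct xs ys) ≡ length xs * length ys
length-cartesianProduct []       ys = refl
length-cartesianProduct (x ∷ xs) ys = trans (length-++ (map (x ,_) ys))
  (cong₂ _+_ (length-map (x ,_) ys) (length-cartesianProduct xs ys))

length-triples : ∀ n →
  length (triples n) ≡ sum (map (λ m → d (n ∸ m) * a (m ∸ 1)) (applyUpTo suc n))
length-triples n = trans (length-concatMap _ (upTo n)) (cong sum (begin
  map (length ∘ fibre) (upTo n)                            ≡⟨ map-cong length-fibre (upTo n) ⟩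
  map (λ m → d (n ∸ suc m) * a m) (upTo n)                 ≡⟨ map-upTo _ n ⟩
  -- Passing from letters counted from 0 to the summation index, which runs from 1 to `n`.
  applyUpTo (λ m → d (n ∸ suc m) * a m) n                  ≡⟨ map-applyUpTo suc _ n ⟨
  map (λ m → d (n ∸ m) * a (m ∸ 1)) (applyUpTo suc n)      ∎))
  where
  open ≡-Reasoning
  fibre : ℕ → List (ℕ × List ℕ × List ℕ)
  fibre m = map (m ,_) (cartesianProduct (derangedWords (n ∸ suc m)) (strongWords m))
  length-fibre : ∀ m → length (fibre m) ≡ d (n ∸ suc m) * a m
  length-fibre m = begin
    length (fibre m)
      ≡⟨ length-map (m ,_) (cartesianProduct (derangedWords (n ∸ suc m)) (strongWords m)) ⟩
    length (cartesianProduct (derangedWords (n ∸ suc m)) (strongWords m))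
      ≡⟨ length-cartesianProduct (derangedWords (n ∸ suc m)) (strongWords m) ⟩
    length (derangedWords (n ∸ suc m)) * length (strongWords m)
      ≡⟨ cong₂ _*_ (length-derangedWords (n ∸ suc m)) (length-strongWords m) ⟩
    d (n ∸ suc m) * a m ∎

-- Gluing is injective and yields avoiders.

lastIsolated-unique : ∀ {u v u′ v′ y y′} →
  All (_< y) u → All (y <_) v → Deranged v → All (_< y′) u′ → All (y′ <_) v′ → Deranged v′ →
  u ++ y ∷ v ≡ u′ ++ y′ ∷ v′ → u ≡ u′ × y ≡ y′ × v ≡ v′
lastIsolated-unique {u} {v} {u′} {v′} {y} {y′} u<y y<v none u′<y′ y′<v′ none′ eq with split u u′ eq
... | middle       = refl , refl , refl
-- If the cuts differ, the later cut letter is isolated inside the suffix that follows the earlier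
-- one, which is `Deranged`.
... | left s refl  = ⊥-elim (none′ s y v refl
  (All.++⁻ʳ [ y′ ] (All.++⁻ʳ u′ u<y) , All.take⁺ 1 y<v))
... | right s refl = ⊥-elim (none s y′ v′ refl
  (All.++⁻ʳ [ y ] (All.++⁻ʳ u u′<y′) , All.take⁺ 1 y′<v′))

glue-injective : ∀ n {t t′} → t ∈ triples n → t′ ∈ triples n → glue t ≡ glue t′ → t ≡ t′
glue-injective n {m , τ , σ} {m′ , τ′ , σ′} t∈ t′∈ eq
  with ∈-triples⁻ n t∈ | ∈-triples⁻ n t′∈
... | _ , τ∈ , σ∈ | _ , τ′∈ , σ′∈
  with lastIsolated-unique
    (proj₁ (proj₂ (proj₁ (∈-strongWords⁻ σ∈)))) (raise-above m τ)
    (raise-Deranged⁺ m (proj₂ (∈-derangedWords⁻ τ∈)))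
    (proj₁ (proj₂ (proj₁ (∈-strongWords⁻ σ′∈)))) (raise-above m′ τ′)
    (raise-Deranged⁺ m′ (proj₂ (∈-derangedWords⁻ τ′∈))) eq
... | refl , refl , eq′ with map-injective (ℕ.+-cancelˡ-≡ (suc m) _ _) eq′
...   | refl = refl

glue-IsPermutation : ∀ {m τ σ} → m < n → IsPermutation (n ∸ suc m) τ → IsPermutation m σ →
                     IsPermutation n (glue (m , τ , σ))
glue-IsPermutation {n} {m} {τ} {σ} m<n (τ! , τ< , ∣τ∣) (σ! , σ< , ∣σ∣) =
    Unique.++⁺ σ!
      (All.map ℕ.<⇒≢ (raise-above m τ) ∷ Unique.map⁺ (ℕ.+-cancelˡ-≡ (suc m) _ _) τ!) disjoint
  , All.++⁺ (All.map (λ x<m → ℕ.<-trans x<m m<n) σ<)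
      (m<n ∷ All.map⁺ (All.map (λ t< → subst (_ <_) (ℕ.m+[n∸m]≡n m<n) (ℕ.+-monoʳ-< (suc m) t<)) τ<))
  , (begin
      length (σ ++ m ∷ raise m τ)          ≡⟨ length-++ σ ⟩
      length σ + suc (length (raise m τ))
        ≡⟨ cong₂ (λ x y → x + suc y) ∣σ∣ (trans (length-map _ τ) ∣τ∣) ⟩
      m + suc (n ∸ suc m)                  ≡⟨ ℕ.+-suc m _ ⟩
      suc m + (n ∸ suc m)                  ≡⟨ ℕ.m+[n∸m]≡n m<n ⟩
      n                                    ∎)
  where
  open ≡-Reasoning
  disjoint : Disjoint σ (m ∷ raise m τ)
  disjoint (x∈σ , here refl) = ℕ.<-irrefl refl (All.lookup σ< x∈σ)
  disjoint (x∈σ , there x∈τ) = ℕ.<-asym (All.lookup σ< x∈σ) (All.lookup (raise-above m τ) x∈τ)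

-- An isolated letter of the glued word is `m` itself or is isolated in `σ` or in the raised `τ`;
-- the last is excluded. For one in `σ`, the letters appended all exceed it.
glue-Strong : ∀ {m τ σ} → All (_< m) σ → Deranged τ → Strong σ → Strong (glue (m , τ , σ))
glue-Strong {m} {τ} {σ} σ<m deranged strong u y v w≡ (u<y , y<v) with split σ u w≡
... | middle = raise-above m τ
... | right s eq = ⊥-elim (raise-Deranged⁺ m deranged s y v eq
    (All.++⁻ʳ [ m ] (All.++⁻ʳ σ u<y) , y<v))
... | left s refl = All.++⁺ (strong u y s refl (u<y , head s y<v))
    (y<m ∷ All.map (ℕ.<-trans y<m) (raise-above m τ))
  where
  y<m : y < m
  y<m = All.lookup σ<m (∈-insert u)
  head : ∀ s → All (y <_) (take 1 (s ++ m ∷ raise m τ)) → All (y <_) (take 1 s)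
  head []      _       = []
  head (_ ∷ _) (p ∷ _) = p ∷ []

-- Cutting an avoider at its last isolated letter.

bounds-tight : ∀ {p q r s} → p ≤ q → r ≤ s → p + suc r ≡ q + suc s → p ≡ q × r ≡ s
bounds-tight {p} {q} {r} {s} p≤q r≤s eq with ℕ.≤-antisym p≤q
  (ℕ.+-cancelʳ-≤ (suc s) q p (ℕ.≤-trans (ℕ.≤-reflexive (sym eq)) (ℕ.+-monoʳ-≤ p (s≤s r≤s))))
... | refl = refl , ℕ.suc-injective (ℕ.+-cancelˡ-≡ p _ _ eq)

length-≤-bound : ∀ {w} → Unique w → All (_< n) w → length w ≤ n
length-≤-bound {n} ! w<n =
  subst (_ ≤_) (length-upTo n) (length-⊆ ! λ x∈ → ∈-upTo⁺ (All.lookup w<n x∈))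

-- At most `m` distinct letters fit below `m` and at most `n ∸ suc m` above it. The total length `n`
-- leaves no slack, so both parts are full permutations.
unglue : ∀ u m v → IsPermutation n (u ++ m ∷ v) → All (_< m) u → All (m <_) v →
         m < n × IsPermutation m u × IsPermutation (n ∸ suc m) (map (_∸ suc m) v)
unglue {n} u m v (! , <n , len) u<m m<v =
  m<n , (u! , u<m , proj₁ tight) , (v₀! , v₀< , proj₂ tight)
  where
  m<n : m < n
  m<n = All.lookup <n (∈-insert u)
  v₀ : List ℕ
  v₀ = map (_∸ suc m) v
  !s = AllPairs-++⁻ u !
  u! = proj₁ !s
  v₀! : Unique v₀
  v₀! = Unique.map⁻ (subst Unique (sym (raise-∸ m m<v)) (AllPairs.tail (proj₁ (proj₂ !s))))
  v₀< : All (_< n ∸ suc m) v₀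
  v₀< = All.map⁺ (All.zipWith (λ (x<n , m<x) → ℕ.∸-monoˡ-< x<n m<x)
    (All.++⁻ʳ [ m ] (All.++⁻ʳ u <n) , m<v))
  open ≡-Reasoning
  tight : length u ≡ m × length v₀ ≡ n ∸ suc m
  tight = bounds-tight (length-≤-bound u! u<m) (length-≤-bound v₀! v₀<) (begin
    length u + suc (length v₀) ≡⟨ cong (λ l → length u + suc l) (length-map _ v) ⟩
    length u + suc (length v)  ≡⟨ length-++ u ⟨
    length (u ++ m ∷ v)        ≡⟨ len ⟩
    n                          ≡⟨ ℕ.m+[n∸m]≡n m<n ⟨
    suc m + (n ∸ suc m)        ≡⟨ ℕ.+-suc m _ ⟨
    m + suc (n ∸ suc m)        ∎)

-- A letter isolated in `u` stays isolated in the whole word: if it ends `u`, the next letter is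
-- `m`, which is larger.
strong-prefix : ∀ {u m v} → All (_< m) u → Strong (u ++ m ∷ v) → Strong u
strong-prefix {m = m} {v} u<m strong u y s refl (u<y , y<s) =
  All.++⁻ˡ s (strong u y (s ++ m ∷ v) (++-assoc u (y ∷ s) (m ∷ v)) (u<y , head s y<s))
  where
  head : ∀ s → All (y <_) (take 1 s) → All (y <_) (take 1 (s ++ m ∷ v))
  head []      _       = All.lookup u<m (∈-insert u) ∷ []
  head (_ ∷ _) (p ∷ _) = p ∷ []

-- All of `u` and `m` lie below the letters of `v`, so a letter isolated in `v` alone would be
-- isolated in the whole word.
deranged-suffix : ∀ {u m v} → All (_< m) u → All (m <_) v →
                  NoneIsolatedFrom (u ∷ʳ m) v → Deranged v
deranged-suffix {u} {m} u<m m<v none s y v refl (s<y , y<v) = none s y v refl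
  (All.++⁺ (All.++⁺ (All.map (λ x<m → ℕ.<-trans x<m m<y) u<m) (m<y ∷ [])) s<y , y<v)
  where m<y = All.lookup m<v (∈-insert s)

-- The decomposition of avoiders and the recurrence.

decomposition : ℕ → List (List ℕ)
decomposition n = derangedWords n ++ map glue (triples n)

strongWords⊆decomposition : ∀ n → strongWords n ⊆ decomposition n
strongWords⊆decomposition n {w} w∈ with ∈-strongWords⁻ w∈ | lastIsolated [] w
-- With the empty prefix, `NoneIsolatedFrom` unfolds to `Deranged`.
... | perm , strong | inj₁ none = ∈-++⁺ˡ (∈-derangedWords⁺ perm none)
... | perm , strong | inj₂ (u , m , v , refl , iso@(u<m , _) , none)
  -- Avoidance is what puts all of `v`, not just its first letter, above `m`.
  with strong u m v refl iso
...   | m<v with unglue u m v perm u<m m<v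
...     | m<n , u-perm , v₀-perm = ∈-++⁺ʳ (derangedWords n)
  (subst (λ v′ → u ++ m ∷ v′ ∈ map glue (triples n)) (raise-∸ m m<v) (∈-map⁺ glue (∈-triples⁺ m<n
    (∈-derangedWords⁺ v₀-perm (raise-Deranged⁻ m
      (subst Deranged (sym (raise-∸ m m<v)) (deranged-suffix u<m m<v none))))
    (∈-strongWords⁺ u-perm (strong-prefix u<m strong)))))

decomposition⊆strongWords : ∀ n → decomposition n ⊆ strongWords n
decomposition⊆strongWords n w∈ with ∈-++⁻ (derangedWords n) w∈
... | inj₁ w∈d with ∈-derangedWords⁻ w∈d
...   | perm , none = ∈-strongWords⁺ perm λ u y v w≡ iso → ⊥-elim (none u y v w≡ iso)
decomposition⊆strongWords n w∈ | inj₂ w∈g with ∈-map⁻ glue w∈g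
... | (m , τ , σ) , t∈ , refl with ∈-triples⁻ n t∈
...   | m<n , τ∈ , σ∈ with ∈-derangedWords⁻ τ∈ | ∈-strongWords⁻ σ∈
...     | τ-perm , deranged | σ-perm , strong = ∈-strongWords⁺ (glue-IsPermutation m<n τ-perm σ-perm)
  (glue-Strong (proj₁ (proj₂ σ-perm)) deranged strong)

decomposition-Unique : ∀ n → Unique (decomposition n)
decomposition-Unique n = Unique.++⁺ (derangedWords-Unique n)
  (Unique-map⁺ glue (glue-injective n) (triples-Unique n)) disjoint
  where
  -- A glued word always has `m` as an isolated letter.
  disjoint : Disjoint (derangedWords n) (map glue (triples n))
  disjoint (w∈d , w∈g) with ∈-map⁻ glue w∈g
  ... | (m , τ , σ) , t∈ , refl = proj₂ (∈-derangedWords⁻ w∈d) σ m (raise m τ) refl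
    ( proj₁ (proj₂ (proj₁ (∈-strongWords⁻ (proj₂ (proj₂ (∈-triples⁻ n t∈))))))
    , All.take⁺ 1 (raise-above m τ) )

theorem4p5 : (n : ℕ) → 1 ≤ n →
    a n ≡ d n + sum (map (λ m → d (n ∸ m) * a (m ∸ 1)) (applyUpTo suc n))
theorem4p5 n _ = begin
  a n                                              ≡⟨ length-strongWords n ⟨
  length (strongWords n)                           ≡⟨ ℕ.≤-antisym
    (length-⊆ (strongWords-Unique n) (strongWords⊆decomposition n))
    (length-⊆ (decomposition-Unique n) (decomposition⊆strongWords n)) ⟩
  length (decomposition n)                         ≡⟨ length-++ (derangedWords n) ⟩
  length (derangedWords n) + length (map glue (triples n))
    ≡⟨ cong₂ _+_ (length-derangedWords n) (trans (length-map glue (triples n)) (length-triples n)) ⟩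
  d n + sum (map (λ m → d (n ∸ m) * a (m ∸ 1)) (applyUpTo suc n)) ∎
  where open ≡-Reasoning
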